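{- Let $C$, $C'$, $P$ and $Q$ be $n\times n$ matrices. Assume that (i) $PCQ\ge PC'Q$ (entrywise); (ii) $C'$ has an eigenvector $Qu$ for $\lambda'$, for some nonnegative column vector $u=(u_1,\ldots,u_n)^T$ and $\lambda'\in\mathbb{R}$; (iii) $C$ has a left eigenvector $v^TP$ for $\lambda$, for some nonnegative row vector $v^T=(v_1,\ldots,v_n)$ and $\lambda\in\mathbb{R}$; and (iv) $v^TPQu>0$. Then $\lambda\ge\lambda'$. Moreover, $\lambda=\lambda'$ if and only if $(PC'Q)_{ij}=(PCQ)_{ij}$ for all $1\le i,j\le n$ with $v_i\ne0$ and $u_j\ne0$.
   Context: All matrices and vectors are real. "Eigenvector" means right eigenvector (so $C'Qu=\lambda'Qu$, $Qu\neq 0$), and a left eigenvector $w^T$ of $C$ for $\lambda$ satisfies $w^TC=\lambda w^T$, $w\ne0$. -}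

module Defs where

-- Real numbers are Cauchy sequences of rationals (no modulus is stored), up to
-- the setoid equality _≈_.  All operations are termwise.  The commutative ring
-- laws are proved here so that the library's finite sums apply to ℝ.

open import Algebra.Bundles using (CommutativeRing)
import Algebra.Properties.Semiring.Sum as SemiringSum
open import Data.Nat.Base as ℕ using (ℕ)
import Data.Nat.Properties as ℕ
open import Data.Product using (∃; _×_; _,_; proj₁; proj₂)
open import Data.Rational.Base as ℚ using (ℚ; 0ℚ; 1ℚ; ∣_∣)
import Data.Rational.Properties as ℚ
open import Data.Rational.Solver using (module +-*-Solver)
open import Data.Vec.Functional using (Vector)
open import Level using (0ℓ)
open import Relation.Binary.PropositionalEquality
  using (_≡_; refl; sym; trans; cong; subst)
open import Relation.Nullary using (¬_)

Eventually : (ℕ → Set) → Set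
Eventually A = ∃ λ N → ∀ n → N ℕ.≤ n → A n

IsCauchy : (ℕ → ℚ) → Set
IsCauchy a = ∀ ε → 0ℚ ℚ.< ε →
  ∃ λ N → ∀ m n → N ℕ.≤ m → N ℕ.≤ n → ∣ a m ℚ.- a n ∣ ℚ.≤ ε

abstract
  2ℚ : ℚ
  2ℚ = 1ℚ ℚ.+ 1ℚ

  0<1 : 0ℚ ℚ.< 1ℚ
  0<1 = ℚ.positive⁻¹ 1ℚ

  pos+ : ∀ p q → 0ℚ ℚ.< p → 0ℚ ℚ.< q → 0ℚ ℚ.< p ℚ.+ q
  pos+ p q = ℚ.+-mono-< {0ℚ} {p} {0ℚ} {q}

  scale : ∀ L ε → 0ℚ ℚ.< L → 0ℚ ℚ.< ε → ∃ λ δ → 0ℚ ℚ.< δ × L ℚ.* δ ≡ ε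
  scale L ε 0<L 0<ε = δ , ℚ.positive⁻¹ δ {{pos}} , eq
    where
    instance
      L⁺ : ℚ.Positive L
      L⁺ = ℚ.positive 0<L
      L≢0 : ℚ.NonZero L
      L≢0 = ℚ.pos⇒nonZero L
    δ : ℚ
    δ = ℚ.1/ L ℚ.* ε
    pos : ℚ.Positive δ
    pos = ℚ.pos*pos⇒pos (ℚ.1/ L) {{ℚ.1/pos⇒pos L}} ε {{ℚ.positive 0<ε}}
    eq : L ℚ.* δ ≡ ε
    eq = trans (sym (ℚ.*-assoc L (ℚ.1/ L) ε))
        (trans (cong (ℚ._* ε) (ℚ.*-inverseʳ L)) (ℚ.*-identityˡ ε))

  halve : ∀ ε → 0ℚ ℚ.< ε → ∃ λ δ → 0ℚ ℚ.< δ × δ ℚ.+ δ ≡ ε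
  halve ε 0<ε =
    let δ , 0<δ , eq = scale 2ℚ ε (pos+ 1ℚ 1ℚ 0<1 0<1) 0<ε
    in  δ , 0<δ , trans (double δ) eq
    where
    open +-*-Solver
    double : ∀ d → d ℚ.+ d ≡ 2ℚ ℚ.* d
    double = solve 1 (λ d → d :+ d := (con 1ℚ :+ con 1ℚ) :* d) refl

  ∣p-p∣≡0 : ∀ p → ∣ p ℚ.- p ∣ ≡ 0ℚ
  ∣p-p∣≡0 p = cong ∣_∣ (ℚ.+-inverseʳ p)

  ∣p-q∣≡∣q-p∣ : ∀ p q → ∣ p ℚ.- q ∣ ≡ ∣ q ℚ.- p ∣
  ∣p-q∣≡∣q-p∣ p q =
    trans (cong ∣_∣ (lem p q)) (ℚ.∣-p∣≡∣p∣ (q ℚ.- p))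
    where
    open +-*-Solver
    lem : ∀ p q → p ℚ.- q ≡ ℚ.- (q ℚ.- p)
    lem = solve 2 (λ p q → p :- q := :- (q :- p)) refl

  split : ∀ {x} y z {α β ε} → x ≡ y ℚ.+ z → α ℚ.+ β ≡ ε →
          ∣ y ∣ ℚ.≤ α → ∣ z ∣ ℚ.≤ β → ∣ x ∣ ℚ.≤ ε
  split y z refl refl y≤ z≤ =
    ℚ.≤-trans (ℚ.∣p+q∣≤∣p∣+∣q∣ y z) (ℚ.+-mono-≤ y≤ z≤)

  +-close : ∀ a a′ b b′ {α β ε} → α ℚ.+ β ≡ ε →
            ∣ a ℚ.- a′ ∣ ℚ.≤ α → ∣ b ℚ.- b′ ∣ ℚ.≤ β →
            ∣ (a ℚ.+ b) ℚ.- (a′ ℚ.+ b′) ∣ ℚ.≤ ε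
  +-close a a′ b b′ = split (a ℚ.- a′) (b ℚ.- b′) (lem a a′ b b′)
    where
    open +-*-Solver
    lem : ∀ a a′ b b′ →
          (a ℚ.+ b) ℚ.- (a′ ℚ.+ b′) ≡ (a ℚ.- a′) ℚ.+ (b ℚ.- b′)
    lem = solve 4 (λ a a′ b b′ →
            (a :+ b) :- (a′ :+ b′) := (a :- a′) :+ (b :- b′)) refl

  trans-close : ∀ a b c {α β ε} → α ℚ.+ β ≡ ε →
                ∣ a ℚ.- b ∣ ℚ.≤ α → ∣ b ℚ.- c ∣ ℚ.≤ β → ∣ a ℚ.- c ∣ ℚ.≤ ε
  trans-close a b c = split (a ℚ.- b) (b ℚ.- c) (lem a b c)
    where
    open +-*-Solver
    lem : ∀ a b c → a ℚ.- c ≡ (a ℚ.- b) ℚ.+ (b ℚ.- c)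
    lem = solve 3 (λ a b c → a :- c := (a :- b) :+ (b :- c)) refl

  neg-close : ∀ a b {ε} → ∣ a ℚ.- b ∣ ℚ.≤ ε → ∣ (ℚ.- a) ℚ.- (ℚ.- b) ∣ ℚ.≤ ε
  neg-close a b = subst (ℚ._≤ _)
    (trans (sym (ℚ.∣-p∣≡∣p∣ (a ℚ.- b))) (cong ∣_∣ (lem a b)))
    where
    open +-*-Solver
    lem : ∀ a b → ℚ.- (a ℚ.- b) ≡ (ℚ.- a) ℚ.- (ℚ.- b)
    lem = solve 2 (λ a b → :- (a :- b) := (:- a) :- (:- b)) refl

  ∣*∣-mono : ∀ a b {K δ} → 0ℚ ℚ.< K → ∣ a ∣ ℚ.≤ K → ∣ b ∣ ℚ.≤ δ →
             ∣ a ℚ.* b ∣ ℚ.≤ K ℚ.* δ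
  ∣*∣-mono a b {K} {δ} 0<K a≤ b≤ = begin
    ∣ a ℚ.* b ∣     ≡⟨ ℚ.∣p*q∣≡∣p∣*∣q∣ a b ⟩
    ∣ a ∣ ℚ.* ∣ b ∣ ≤⟨ ℚ.*-monoʳ-≤-nonNeg ∣ b ∣ {{ℚ.∣-∣-nonNeg b}} a≤ ⟩
    K ℚ.* ∣ b ∣     ≤⟨ ℚ.*-monoˡ-≤-nonNeg K {{ℚ.nonNegative (ℚ.<⇒≤ 0<K)}} b≤ ⟩
    K ℚ.* δ         ∎
    where open ℚ.≤-Reasoning

  *-close : ∀ a a′ b b′ {K L δ ε} → (K ℚ.+ L) ℚ.* δ ≡ ε →
            0ℚ ℚ.< K → 0ℚ ℚ.< L → ∣ a ∣ ℚ.≤ K → ∣ b′ ∣ ℚ.≤ L →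
            ∣ a ℚ.- a′ ∣ ℚ.≤ δ → ∣ b ℚ.- b′ ∣ ℚ.≤ δ →
            ∣ (a ℚ.* b) ℚ.- (a′ ℚ.* b′) ∣ ℚ.≤ ε
  *-close a a′ b b′ {K} {L} {δ} eq 0<K 0<L a≤ b′≤ a~ b~ =
    split (a ℚ.* (b ℚ.- b′)) (b′ ℚ.* (a ℚ.- a′)) (lem a a′ b b′)
      (trans (sym (ℚ.*-distribʳ-+ δ K L)) eq)
      (∣*∣-mono a (b ℚ.- b′) 0<K a≤ b~) (∣*∣-mono b′ (a ℚ.- a′) 0<L b′≤ a~)
    where
    open +-*-Solver
    lem : ∀ a a′ b b′ → (a ℚ.* b) ℚ.- (a′ ℚ.* b′)
        ≡ (a ℚ.* (b ℚ.- b′)) ℚ.+ (b′ ℚ.* (a ℚ.- a′))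
    lem = solve 4 (λ a a′ b b′ → (a :* b) :- (a′ :* b′)
        := (a :* (b :- b′)) :+ (b′ :* (a :- a′))) refl

  bounded : ∀ a → IsCauchy a →
            ∃ λ K → 0ℚ ℚ.< K × Eventually (λ n → ∣ a n ∣ ℚ.≤ K)
  bounded a ca =
    let N , near = ca 1ℚ 0<1
    in  ∣ a N ∣ ℚ.+ 1ℚ
      , ℚ.+-mono-≤-< (ℚ.0≤∣p∣ (a N)) 0<1
      , N , λ n N≤n → split (a N) (a n ℚ.- a N) (lem (a n) (a N)) refl
                        ℚ.≤-refl (near n N N≤n ℕ.≤-refl)
    where
    open +-*-Solver
    lem : ∀ p q → p ≡ q ℚ.+ (p ℚ.- q)
    lem = solve 2 (λ p q → p := q :+ (p :- q)) refl

  both : ∀ M N → ∃ λ R → ∀ {n} → R ℕ.≤ n → M ℕ.≤ n × N ℕ.≤ n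
  both M N = M ℕ.⊔ N , λ p → ℕ.m⊔n≤o⇒m≤o M N p , ℕ.m⊔n≤o⇒n≤o M N p

  const-cauchy : ∀ q → IsCauchy (λ _ → q)
  const-cauchy q ε 0<ε =
    0 , λ _ _ _ _ → subst (ℚ._≤ ε) (sym (∣p-p∣≡0 q)) (ℚ.<⇒≤ 0<ε)

  +-cauchy : ∀ a b → IsCauchy a → IsCauchy b → IsCauchy (λ n → a n ℚ.+ b n)
  +-cauchy a b ca cb ε 0<ε =
    let δ , 0<δ , eq = halve ε 0<ε
        M , f        = ca δ 0<δ
        N , g        = cb δ 0<δ
        R , to       = both M N
    in  R , λ m n p q → +-close (a m) (a n) (b m) (b n) eq
          (f m n (proj₁ (to p)) (proj₁ (to q)))
          (g m n (proj₂ (to p)) (proj₂ (to q)))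

  neg-cauchy : ∀ a → IsCauchy a → IsCauchy (λ n → ℚ.- a n)
  neg-cauchy a ca ε 0<ε =
    let N , f = ca ε 0<ε
    in  N , λ m n p q → neg-close (a m) (a n) (f m n p q)

  *-cauchy : ∀ a b → IsCauchy a → IsCauchy b → IsCauchy (λ n → a n ℚ.* b n)
  *-cauchy a b ca cb ε 0<ε =
    let K , 0<K , M , a≤ = bounded a ca
        L , 0<L , N , b≤ = bounded b cb
        δ , 0<δ , eq     = scale (K ℚ.+ L) ε (pos+ K L 0<K 0<L) 0<ε
        M′ , f           = ca δ 0<δ
        N′ , g           = cb δ 0<δ
        R , to           = both M N
        R′ , to′         = both M′ N′
        T , to″          = both R R′
    in  T , λ m n p q → *-close (a m) (a n) (b m) (b n) eq 0<K 0<L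
          (a≤ m (proj₁ (to (proj₁ (to″ p)))))
          (b≤ n (proj₂ (to (proj₁ (to″ q)))))
          (f m n (proj₁ (to′ (proj₂ (to″ p)))) (proj₁ (to′ (proj₂ (to″ q)))))
          (g m n (proj₂ (to′ (proj₂ (to″ p)))) (proj₂ (to′ (proj₂ (to″ q)))))

record ℝ : Set where
  constructor mkℝ
  field
    seq    : ℕ → ℚ
    cauchy : IsCauchy seq

open ℝ public

infix  4 _≈_ _≉_ _≤_ _<_ _≥_ _>_
infixl 6 _+_
infixl 7 _*_
infix  8 -_

-- The three relations are records, not abbreviations, so that their arguments
-- can be inferred.  Both _≈_ and _≤_ are ¬¬-stable, so the plain negation _≉_ is
-- a workable reading of ≠; no apartness is involved.

record _≈_ (x y : ℝ) : Set where
  constructor mk≈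
  field
    close : ∀ ε → 0ℚ ℚ.< ε → Eventually (λ n → ∣ seq x n ℚ.- seq y n ∣ ℚ.≤ ε)

record _≤_ (x y : ℝ) : Set where
  constructor mk≤
  field
    below : ∀ ε → 0ℚ ℚ.< ε → Eventually (λ n → seq x n ℚ.≤ seq y n ℚ.+ ε)

record _<_ (x y : ℝ) : Set where
  constructor mk<
  field
    gap       : ℚ
    gap>0     : 0ℚ ℚ.< gap
    separated : Eventually (λ n → seq x n ℚ.+ gap ℚ.≤ seq y n)

open _≈_ public
open _≤_ public
open _<_ public

_≉_ _≥_ _>_ : ℝ → ℝ → Set
x ≉ y = ¬ (x ≈ y)
x ≥ y = y ≤ x
x > y = y < x

fromℚ : ℚ → ℝ
fromℚ q = mkℝ (λ _ → q) (const-cauchy q)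

0ℝ 1ℝ : ℝ
0ℝ = fromℚ 0ℚ
1ℝ = fromℚ 1ℚ

_+_ _*_ : ℝ → ℝ → ℝ
x + y = mkℝ (λ n → seq x n ℚ.+ seq y n) (+-cauchy (seq x) (seq y) (cauchy x) (cauchy y))
x * y = mkℝ (λ n → seq x n ℚ.* seq y n) (*-cauchy (seq x) (seq y) (cauchy x) (cauchy y))

-_ : ℝ → ℝ
- x = mkℝ (λ n → ℚ.- seq x n) (neg-cauchy (seq x) (cauchy x))

termwise : ∀ {x y} → (∀ n → seq x n ≡ seq y n) → x ≈ y
termwise {x} {y} eq = mk≈ λ ε 0<ε → 0 , λ n _ →
  subst (ℚ._≤ ε)
    (sym (trans (cong (λ q → ∣ q ℚ.- seq y n ∣) (eq n)) (∣p-p∣≡0 (seq y n))))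
    (ℚ.<⇒≤ 0<ε)

≈-refl : ∀ {x} → x ≈ x
≈-refl = termwise λ _ → refl

≈-sym : ∀ {x y} → x ≈ y → y ≈ x
≈-sym {x} {y} x≈y = mk≈ λ ε 0<ε → let N , f = close x≈y ε 0<ε in
  N , λ n N≤n → subst (ℚ._≤ ε) (∣p-q∣≡∣q-p∣ (seq x n) (seq y n)) (f n N≤n)

≈-trans : ∀ {x y z} → x ≈ y → y ≈ z → x ≈ z
≈-trans {x} {y} {z} x≈y y≈z = mk≈ λ ε 0<ε →
  let δ , 0<δ , eq = halve ε 0<ε
      M , f        = close x≈y δ 0<δ
      N , g        = close y≈z δ 0<δ
      R , to       = both M N
  in  R , λ n p → trans-close (seq x n) (seq y n) (seq z n) eq
        (f n (proj₁ (to p))) (g n (proj₂ (to p)))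

+-cong : ∀ {x x′ y y′} → x ≈ x′ → y ≈ y′ → x + y ≈ x′ + y′
+-cong {x} {x′} {y} {y′} x≈ y≈ = mk≈ λ ε 0<ε →
  let δ , 0<δ , eq = halve ε 0<ε
      M , f        = close x≈ δ 0<δ
      N , g        = close y≈ δ 0<δ
      R , to       = both M N
  in  R , λ n p → +-close (seq x n) (seq x′ n) (seq y n) (seq y′ n) eq
        (f n (proj₁ (to p))) (g n (proj₂ (to p)))

-‿cong : ∀ {x y} → x ≈ y → - x ≈ - y
-‿cong {x} {y} x≈y = mk≈ λ ε 0<ε → let N , f = close x≈y ε 0<ε in
  N , λ n N≤n → neg-close (seq x n) (seq y n) (f n N≤n)

*-cong : ∀ {x x′ y y′} → x ≈ x′ → y ≈ y′ → x * y ≈ x′ * y′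
*-cong {x} {x′} {y} {y′} x≈ y≈ = mk≈ λ ε 0<ε →
  let K , 0<K , M , x≤  = bounded (seq x) (cauchy x)
      L , 0<L , N , y′≤ = bounded (seq y′) (cauchy y′)
      δ , 0<δ , eq      = scale (K ℚ.+ L) ε (pos+ K L 0<K 0<L) 0<ε
      M′ , f            = close x≈ δ 0<δ
      N′ , g            = close y≈ δ 0<δ
      R , to            = both M N
      R′ , to′          = both M′ N′
      T , to″           = both R R′
  in  T , λ n p → *-close (seq x n) (seq x′ n) (seq y n) (seq y′ n) eq 0<K 0<L
        (x≤ n (proj₁ (to (proj₁ (to″ p)))))
        (y′≤ n (proj₂ (to (proj₁ (to″ p)))))
        (f n (proj₁ (to′ (proj₂ (to″ p)))))
        (g n (proj₂ (to′ (proj₂ (to″ p)))))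

+-*-commutativeRing : CommutativeRing 0ℓ 0ℓ
+-*-commutativeRing = record
  { Carrier = ℝ ; _≈_ = _≈_
  ; _+_ = _+_ ; _*_ = _*_ ; -_ = -_ ; 0# = 0ℝ ; 1# = 1ℝ
  ; isCommutativeRing = record
    { isRing = record
      { +-isAbelianGroup = record
        { isGroup = record
          { isMonoid = record
            { isSemigroup = record
              { isMagma = record
                { isEquivalence = record
                  { refl = ≈-refl ; sym = ≈-sym ; trans = ≈-trans }
                ; ∙-cong = +-cong
                }
              ; assoc = λ x y z → termwise λ n →
                  ℚ.+-assoc (seq x n) (seq y n) (seq z n)
              }
            ; identity = (λ x → termwise λ n → ℚ.+-identityˡ (seq x n))
                       , (λ x → termwise λ n → ℚ.+-identityʳ (seq x n))
            }
          ; inverse = (λ x → termwise λ n → ℚ.+-inverseˡ (seq x n))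
                    , (λ x → termwise λ n → ℚ.+-inverseʳ (seq x n))
          ; ⁻¹-cong = -‿cong
          }
        ; comm = λ x y → termwise λ n → ℚ.+-comm (seq x n) (seq y n)
        }
      ; *-cong = *-cong
      ; *-assoc = λ x y z → termwise λ n →
          ℚ.*-assoc (seq x n) (seq y n) (seq z n)
      ; *-identity = (λ x → termwise λ n → ℚ.*-identityˡ (seq x n))
                   , (λ x → termwise λ n → ℚ.*-identityʳ (seq x n))
      ; distrib = (λ x y z → termwise λ n →
                    ℚ.*-distribˡ-+ (seq x n) (seq y n) (seq z n))
                , (λ x y z → termwise λ n →
                    ℚ.*-distribʳ-+ (seq x n) (seq y n) (seq z n))
      }
    ; *-comm = λ x y → termwise λ n → ℚ.*-comm (seq x n) (seq y n)
    }
  }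

open SemiringSum (CommutativeRing.semiring +-*-commutativeRing) public using (sum)

Vec : ℕ → Set
Vec n = Vector ℝ n

Matrix : ℕ → Set
Matrix n = Vector (Vector ℝ n) n

private
  variable
    n : ℕ

infix  4 _≈ᵛ_ _≥ᴹ_
infixl 7 _*ᴹ_ _ᵛ*ᴹ_ _∙_
infixr 7 _ᴹ*ᵛ_ _·_

_≈ᵛ_ : Vec n → Vec n → Set
x ≈ᵛ y = ∀ i → x i ≈ y i

0ᵛ : Vec n
0ᵛ _ = 0ℝ

_·_ : ℝ → Vec n → Vec n
(c · x) i = c * x i

_∙_ : Vec n → Vec n → ℝ
x ∙ y = sum λ i → x i * y i

_*ᴹ_ : Matrix n → Matrix n → Matrix n
(A *ᴹ B) i k = sum λ j → A i j * B j k

_ᴹ*ᵛ_ : Matrix n → Vec n → Vec n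
(A ᴹ*ᵛ x) i = sum λ j → A i j * x j

_ᵛ*ᴹ_ : Vec n → Matrix n → Vec n
(x ᵛ*ᴹ A) j = sum λ i → x i * A i j

_≥ᴹ_ : Matrix n → Matrix n → Set
A ≥ᴹ B = ∀ i j → A i j ≥ B i j

NonNegative : Vec n → Set
NonNegative x = ∀ i → x i ≥ 0ℝ

IsRightEigenvector : Matrix n → ℝ → Vec n → Set
IsRightEigenvector A μ x = (A ᴹ*ᵛ x ≈ᵛ μ · x) × ¬ (x ≈ᵛ 0ᵛ)

IsLeftEigenvector : Matrix n → ℝ → Vec n → Set
IsLeftEigenvector A μ x = (x ᵛ*ᴹ A ≈ᵛ μ · x) × ¬ (x ≈ᵛ 0ᵛ)

{-# OPTIONS --safe #-}
module Submission where

-- Put s = vᵀPQu > 0 and D = PCQ − PC′Q ≥ 0.  The eigenvector equations give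
-- vᵀDu = (λ − λ′)s, and the left side is a sum of nonnegative terms, so λ ≥ λ′,
-- with equality iff every v i * D i j * u j vanishes.  Constructively this needs
-- x * y ≈ 0 to be equivalent to (x ≉ 0 → y ≈ 0); it is, because a Cauchy sequence
-- of rationals is, for each ε, either eventually within ε of 0 or bounded away
-- from 0, and so _≈ 0ℝ is ¬¬-stable.

open import Defs
open import Algebra.Bundles using (CommutativeRing)
import Algebra.Properties.CommutativeMonoid.Sum as CommutativeMonoidSum
import Algebra.Properties.Group as GroupProperties
import Algebra.Properties.Ring as RingProperties
import Algebra.Properties.Semiring.Sum as SemiringSum
open import Data.Nat using (ℕ)
import Data.Nat as ℕ
import Data.Nat.Properties as ℕ
open import Data.Fin using (Fin; zero; suc)
open import Data.Product using (∃; _×_; _,_; proj₁; proj₂)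
open import Data.Rational using (0ℚ; ∣_∣)
import Data.Rational as ℚ
import Data.Rational.Properties as ℚ
open import Data.Rational.Solver using (module +-*-Solver)
open import Data.Sum using (_⊎_; inj₁; inj₂)
open import Function.Base using (_∘_)
open import Function.Bundles using (_⇔_; mk⇔)
open import Relation.Binary.PropositionalEquality
  using (_≡_; refl; sym; trans; cong; subst; subst₂)
import Relation.Binary.Reasoning.Setoid as SetoidReasoning
open import Relation.Nullary using (¬_; yes; no; contradiction)

open CommutativeRing +-*-commutativeRing
  using ( setoid; semiring; ring; +-group; +-commutativeMonoid
        ; +-identityˡ; +-identityʳ; +-comm; +-assoc; *-comm; *-assoc
        ; -‿inverseˡ; -‿inverseʳ; distribˡ; distribʳ; zeroˡ; zeroʳ; *-congˡ; *-congʳ )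
open SemiringSum semiring using (*-distribˡ-sum; *-distribʳ-sum; sum-cong-≋)
open CommutativeMonoidSum +-commutativeMonoid using (∑-comm; ∑-distrib-+)
open GroupProperties +-group
  using (x∙y⁻¹≈ε⇒x≈y; x≈y⇒x∙y⁻¹≈ε; //-rightDividesˡ; //-rightDividesʳ)
open RingProperties ring using ([y-z]x≈yx-zx)

private
  variable
    n : ℕ
    x y z : ℝ

-- Rational inequalities

p≤∣p∣ : ∀ p → p ℚ.≤ ∣ p ∣
p≤∣p∣ p with ℚ.≤-total 0ℚ p
... | inj₁ 0≤p = ℚ.≤-reflexive (sym (ℚ.0≤p⇒∣p∣≡p 0≤p))
... | inj₂ p≤0 = ℚ.≤-trans p≤0 (ℚ.0≤∣p∣ p)

p-q≤r⇒p≤q+r : ∀ p q {r} → p ℚ.- q ℚ.≤ r → p ℚ.≤ q ℚ.+ r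
p-q≤r⇒p≤q+r p q {r} h = subst (ℚ._≤ q ℚ.+ r) (eq p q) (ℚ.+-monoʳ-≤ q h)
  where
  open +-*-Solver
  eq : ∀ p q → q ℚ.+ (p ℚ.- q) ≡ p
  eq = solve 2 (λ p q → q :+ (p :- q) := p) refl

p≤q+r⇒p-q≤r : ∀ p q r → p ℚ.≤ q ℚ.+ r → p ℚ.- q ℚ.≤ r
p≤q+r⇒p-q≤r p q r h = subst (p ℚ.- q ℚ.≤_) (eq q r) (ℚ.+-monoˡ-≤ (ℚ.- q) h)
  where
  open +-*-Solver
  eq : ∀ q r → (q ℚ.+ r) ℚ.- q ≡ r
  eq = solve 2 (λ q r → (q :+ r) :- q := r) refl

∣p-q∣≤r⇒p≤q+r : ∀ p q {r} → ∣ p ℚ.- q ∣ ℚ.≤ r → p ℚ.≤ q ℚ.+ r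
∣p-q∣≤r⇒p≤q+r p q h = p-q≤r⇒p≤q+r p q (ℚ.≤-trans (p≤∣p∣ (p ℚ.- q)) h)

∣p-q∣≤r⇒∣p∣≤∣q∣+r : ∀ p q {r} → ∣ p ℚ.- q ∣ ℚ.≤ r → ∣ p ∣ ℚ.≤ ∣ q ∣ ℚ.+ r
∣p-q∣≤r⇒∣p∣≤∣q∣+r p q h = split q (p ℚ.- q) (eq p q) refl ℚ.≤-refl h
  where
  open +-*-Solver
  eq : ∀ p q → p ≡ q ℚ.+ (p ℚ.- q)
  eq = solve 2 (λ p q → p := q :+ (p :- q)) refl

∣p-q∣≤r : ∀ p q r → p ℚ.≤ q ℚ.+ r → q ℚ.≤ p ℚ.+ r → ∣ p ℚ.- q ∣ ℚ.≤ r
∣p-q∣≤r p q r p≤ q≤ with ℚ.∣p∣≡p∨∣p∣≡-p (p ℚ.- q)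
... | inj₁ eq = subst (ℚ._≤ r) (sym eq) (p≤q+r⇒p-q≤r p q r p≤)
... | inj₂ eq = subst (ℚ._≤ r) (sym (trans eq (swap p q))) (p≤q+r⇒p-q≤r q p r q≤)
  where
  open +-*-Solver
  swap : ∀ p q → ℚ.- (p ℚ.- q) ≡ q ℚ.- p
  swap = solve 2 (λ p q → :- (p :- q) := q :- p) refl

-- If ∣p∣ is -p, the hypothesis itself reads ∣p∣ ≤ r. This turns the tolerance in `_≤_` into a
-- decidable split on single terms.
0≤p+r⇒0≤p⊎∣p∣≤r : ∀ p r → 0ℚ ℚ.≤ p ℚ.+ r → 0ℚ ℚ.≤ p ⊎ ∣ p ∣ ℚ.≤ r
0≤p+r⇒0≤p⊎∣p∣≤r p r h with ℚ.∣p∣≡p∨∣p∣≡-p p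
... | inj₁ eq = inj₁ (ℚ.∣p∣≡p⇒0≤p eq)
... | inj₂ eq = inj₂ (subst (ℚ._≤ r) (trans (ℚ.+-identityˡ (ℚ.- p)) (sym eq))
                  (p≤q+r⇒p-q≤r 0ℚ p r h))

∣p∣≤r⇒0≤p+r : ∀ p {r} → ∣ p ∣ ℚ.≤ r → 0ℚ ℚ.≤ p ℚ.+ r
∣p∣≤r⇒0≤p+r p {r} h = ∣p-q∣≤r⇒p≤q+r 0ℚ p
  (subst (ℚ._≤ r) (trans (cong ∣_∣ (sym (ℚ.+-identityʳ p))) (∣p-q∣≡∣q-p∣ p 0ℚ)) h)

0≤p*q : ∀ p q → 0ℚ ℚ.≤ p → 0ℚ ℚ.≤ q → 0ℚ ℚ.≤ p ℚ.* q
0≤p*q p q 0≤p 0≤q = ℚ.nonNegative⁻¹ (p ℚ.* q)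
  {{ℚ.nonNeg*nonNeg⇒nonNeg p {{ℚ.nonNegative 0≤p}} q {{ℚ.nonNegative 0≤q}}}}

-- Order on ℝ

≈⇒≤ : x ≈ y → x ≤ y
≈⇒≤ {x} {y} x≈y = mk≤ λ ε 0<ε → let N , f = close x≈y ε 0<ε in
  N , λ n N≤n → ∣p-q∣≤r⇒p≤q+r (seq x n) (seq y n) (f n N≤n)

≤-trans : x ≤ y → y ≤ z → x ≤ z
≤-trans {x} {y} {z} x≤y y≤z = mk≤ λ ε 0<ε →
  let δ , 0<δ , eq = halve ε 0<ε
      M , f        = below x≤y δ 0<δ
      N , g        = below y≤z δ 0<δ
      R , to       = both M N
  in  R , λ n p → ℚ.≤-trans (f n (proj₁ (to p)))
        (ℚ.≤-trans (ℚ.+-monoˡ-≤ δ (g n (proj₂ (to p))))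
          (ℚ.≤-reflexive (trans (ℚ.+-assoc (seq z n) δ δ) (cong (seq z n ℚ.+_) eq))))

≤-antisym : x ≤ y → y ≤ x → x ≈ y
≤-antisym {x} {y} x≤y y≤x = mk≈ λ ε 0<ε →
  let M , f  = below x≤y ε 0<ε
      N , g  = below y≤x ε 0<ε
      R , to = both M N
  in  R , λ n p → ∣p-q∣≤r (seq x n) (seq y n) ε (f n (proj₁ (to p))) (g n (proj₂ (to p)))

+-monoˡ-≤ : ∀ z → x ≤ y → x + z ≤ y + z
+-monoˡ-≤ {x} {y} z x≤y = mk≤ λ ε 0<ε → let N , f = below x≤y ε 0<ε in
  N , λ n N≤n → ℚ.≤-trans (ℚ.+-monoˡ-≤ (seq z n) (f n N≤n))
    (ℚ.≤-reflexive (eq (seq y n) ε (seq z n)))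
  where
  open +-*-Solver
  eq : ∀ p q r → (p ℚ.+ q) ℚ.+ r ≡ (p ℚ.+ r) ℚ.+ q
  eq = solve 3 (λ p q r → (p :+ q) :+ r := (p :+ r) :+ q) refl

0≤y⇒x≤x+y : ∀ x → 0ℝ ≤ y → x ≤ x + y
0≤y⇒x≤x+y {y} x 0≤y = ≤-trans (≈⇒≤ (≈-sym (+-identityˡ x)))
  (≤-trans (+-monoˡ-≤ x 0≤y) (≈⇒≤ (+-comm y x)))

x≤y⇒0≤y-x : x ≤ y → 0ℝ ≤ y + - x
x≤y⇒0≤y-x {x} x≤y = ≤-trans (≈⇒≤ (≈-sym (-‿inverseʳ x))) (+-monoˡ-≤ (- x) x≤y)

0≤y-x⇒x≤y : 0ℝ ≤ y + - x → x ≤ y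
0≤y-x⇒x≤y {y} {x} h = ≤-trans (≈⇒≤ (≈-sym (+-identityˡ x)))
  (≤-trans (+-monoˡ-≤ x h) (≈⇒≤ (begin
    (y + - x) + x ≈⟨ +-assoc y (- x) x ⟩
    y + (- x + x) ≈⟨ +-cong ≈-refl (-‿inverseˡ x) ⟩
    y + 0ℝ        ≈⟨ +-identityʳ y ⟩
    y             ∎)))
  where open SetoidReasoning setoid

-- Terms of a nonnegative real may dip slightly below 0, so two of them can have a negative product.
-- In that case one factor is tiny and the other is bounded, so the product is still at least -ε.
0≤x*y : 0ℝ ≤ x → 0ℝ ≤ y → 0ℝ ≤ x * y
0≤x*y {x} {y} 0≤x 0≤y = mk≤ λ ε 0<ε →
  let K , 0<K , M , x≤ = bounded (seq x) (cauchy x)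
      L , 0<L , N , y≤ = bounded (seq y) (cauchy y)
      -- The tolerances are crossed: `y` gets δ = ε/K because ∣x∣ ≤ K, and `x` gets γ = ε/L because
      -- ∣y∣ ≤ L.
      δ , 0<δ , Kδ≡ε   = scale K ε 0<K 0<ε
      γ , 0<γ , Lγ≡ε   = scale L ε 0<L 0<ε
      M′ , f           = below 0≤x γ 0<γ
      N′ , g           = below 0≤y δ 0<δ
      R , to           = both M N
      R′ , to′         = both M′ N′
      T , to″          = both R R′
  in  T , λ n p →
        let a = seq x n
            b = seq y n
            ∣a∣≤K = x≤ n (proj₁ (to (proj₁ (to″ p))))
            ∣b∣≤L = y≤ n (proj₂ (to (proj₁ (to″ p))))
            small = λ {r} (h : ∣ a ℚ.* b ∣ ℚ.≤ r) (eq : r ≡ ε) →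
              ∣p∣≤r⇒0≤p+r (a ℚ.* b) (subst (∣ a ℚ.* b ∣ ℚ.≤_) eq h)
        in case₂ (0≤p+r⇒0≤p⊎∣p∣≤r a γ (f n (proj₁ (to′ (proj₂ (to″ p))))))
                 (0≤p+r⇒0≤p⊎∣p∣≤r b δ (g n (proj₂ (to′ (proj₂ (to″ p))))))
             (λ 0≤a 0≤b → ℚ.+-mono-≤ (0≤p*q a b 0≤a 0≤b) (ℚ.<⇒≤ 0<ε))
             (λ ∣a∣≤γ → small
               (subst (λ q → ∣ q ∣ ℚ.≤ L ℚ.* γ) (ℚ.*-comm b a) (∣*∣-mono b a 0<L ∣b∣≤L ∣a∣≤γ))
               Lγ≡ε)
             (λ ∣b∣≤δ → small (∣*∣-mono a b 0<K ∣a∣≤K ∣b∣≤δ) Kδ≡ε)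
  where
  case₂ : {A B C D E : Set} → A ⊎ B → C ⊎ D → (A → C → E) → (B → E) → (D → E) → E
  case₂ (inj₁ a) (inj₁ c) f _ _ = f a c
  case₂ (inj₂ b) _        _ g _ = g b
  case₂ (inj₁ _) (inj₂ d) _ _ h = h d

-- Only the rational gap g, an eventual lower bound for `y`, is cancelled. For a term a ≤ 0,
-- replacing b ≥ g by g can only increase the product, so 0 ≤ a * g + g * ε, and g divides out.
0≤x*y∧0<y⇒0≤x : 0ℝ ≤ x * y → 0ℝ < y → 0ℝ ≤ x
0≤x*y∧0<y⇒0≤x {x} {y} 0≤xy (mk< g 0<g (M , y≥g)) = mk≤ λ ε 0<ε →
  let N , f  = below 0≤xy (g ℚ.* ε) (0<gε ε 0<ε)
      R , to = both M N
  in  R , λ n p → step (seq x n) (seq y n) ε 0<ε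
        (subst (ℚ._≤ seq y n) (ℚ.+-identityˡ g) (y≥g n (proj₁ (to p))))
        (f n (proj₂ (to p)))
  where
  open +-*-Solver
  instance
    g⁺ : ℚ.Positive g
    g⁺ = ℚ.positive 0<g
  0<gε : ∀ ε → 0ℚ ℚ.< ε → 0ℚ ℚ.< g ℚ.* ε
  0<gε ε 0<ε = ℚ.positive⁻¹ (g ℚ.* ε) {{ℚ.pos*pos⇒pos g ε {{ℚ.positive 0<ε}}}}
  eq : ∀ a ε → a ℚ.* g ℚ.+ g ℚ.* ε ≡ g ℚ.* (a ℚ.+ ε)
  eq a ε = solve 3 (λ a g ε → a :* g :+ g :* ε := g :* (a :+ ε)) refl a g ε
  step : ∀ a b ε → 0ℚ ℚ.< ε → g ℚ.≤ b → 0ℚ ℚ.≤ a ℚ.* b ℚ.+ g ℚ.* ε → 0ℚ ℚ.≤ a ℚ.+ ε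
  step a b ε 0<ε g≤b h with ℚ.≤-total 0ℚ a
  ... | inj₁ 0≤a = ℚ.+-mono-≤ 0≤a (ℚ.<⇒≤ 0<ε)
  ... | inj₂ a≤0 = ℚ.*-cancelˡ-≤-pos g (begin
    g ℚ.* 0ℚ               ≡⟨ ℚ.*-zeroʳ g ⟩
    0ℚ                     ≤⟨ h ⟩
    a ℚ.* b ℚ.+ g ℚ.* ε    ≤⟨ ℚ.+-monoˡ-≤ (g ℚ.* ε)
                                (ℚ.*-monoˡ-≤-nonPos a {{ℚ.nonPositive a≤0}} g≤b) ⟩
    a ℚ.* g ℚ.+ g ℚ.* ε    ≡⟨ eq a ε ⟩
    g ℚ.* (a ℚ.+ ε)        ∎)
    where open ℚ.≤-Reasoning

-- Apartness from zero

-- A witnessed form of `_≉ 0ℝ`: the explicit bound δ is what makes cancellation of a factor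
-- possible. The absolute value leaves the sign open.
Apart₀ : ℝ → Set
Apart₀ x = ∃ λ δ → 0ℚ ℚ.< δ × Eventually (λ n → δ ℚ.≤ ∣ seq x n ∣)

0<x⇒apart₀ : 0ℝ < x → Apart₀ x
0<x⇒apart₀ {x} (mk< g 0<g (N , f)) = g , 0<g , N , λ n N≤n →
  ℚ.≤-trans (subst (ℚ._≤ seq x n) (ℚ.+-identityˡ g) (f n N≤n)) (p≤∣p∣ (seq x n))

eventually-small⇒≈0 : (∀ ε → 0ℚ ℚ.< ε → Eventually (λ n → ∣ seq x n ∣ ℚ.≤ ε)) → x ≈ 0ℝ
eventually-small⇒≈0 {x} h = mk≈ λ ε 0<ε → let N , f = h ε 0<ε in
  N , λ n N≤n → subst (λ q → ∣ q ∣ ℚ.≤ ε) (sym (ℚ.+-identityʳ (seq x n))) (f n N≤n)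

≈0⇒eventually-small : x ≈ 0ℝ → ∀ ε → 0ℚ ℚ.< ε → Eventually (λ n → ∣ seq x n ∣ ℚ.≤ ε)
≈0⇒eventually-small {x} x≈0 ε 0<ε = let N , f = close x≈0 ε 0<ε in
  N , λ n N≤n → subst (λ q → ∣ q ∣ ℚ.≤ ε) (ℚ.+-identityʳ (seq x n)) (f n N≤n)

-- The alternatives overlap, so one late term decides: it is compared with δ in ℚ, and all later
-- terms stay within γ of it.
small⊎apart₀ : ∀ x ε → 0ℚ ℚ.< ε → Eventually (λ n → ∣ seq x n ∣ ℚ.≤ ε) ⊎ Apart₀ x
small⊎apart₀ x ε 0<ε
  -- With δ = ε/2 and γ = ε/4, the tail is at most δ + γ ≤ ε in the first case and at least δ - γ =
  -- γ in the second.
  with δ , 0<δ , δ+δ≡ε ← halve ε 0<ε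
  with γ , 0<γ , γ+γ≡δ ← halve δ 0<δ
  with N , near ← cauchy x γ 0<γ
  with ∣ seq x N ∣ ℚ.≤? δ
... | yes h = inj₁ (N , λ n N≤n → begin
        ∣ seq x n ∣         ≤⟨ ∣p-q∣≤r⇒∣p∣≤∣q∣+r (seq x n) (seq x N) (near n N N≤n ℕ.≤-refl) ⟩
        ∣ seq x N ∣ ℚ.+ γ   ≤⟨ ℚ.+-mono-≤ h γ≤δ ⟩
        δ ℚ.+ δ             ≡⟨ δ+δ≡ε ⟩
        ε                   ∎)
  where
  open ℚ.≤-Reasoning
  γ≤δ : γ ℚ.≤ δ
  γ≤δ = subst₂ ℚ._≤_ (ℚ.+-identityʳ γ) γ+γ≡δ (ℚ.+-monoʳ-≤ γ (ℚ.<⇒≤ 0<γ))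
... | no h = inj₂ (γ , 0<γ , N , λ n N≤n → begin
        γ                           ≡⟨ eq γ ⟩
        (γ ℚ.+ γ) ℚ.- γ             ≡⟨ cong (ℚ._- γ) γ+γ≡δ ⟩
        δ ℚ.- γ                     ≤⟨ ℚ.+-monoˡ-≤ (ℚ.- γ) (ℚ.<⇒≤ (ℚ.≰⇒> h)) ⟩
        ∣ seq x N ∣ ℚ.- γ           ≤⟨ p≤q+r⇒p-q≤r (∣ seq x N ∣) γ (∣ seq x n ∣)
                                         (subst (∣ seq x N ∣ ℚ.≤_) (ℚ.+-comm (∣ seq x n ∣) γ)
                                           (∣p-q∣≤r⇒∣p∣≤∣q∣+r (seq x N) (seq x n)
                                             (near N n ℕ.≤-refl N≤n))) ⟩
        ∣ seq x n ∣                 ∎)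
  where
  open ℚ.≤-Reasoning
  open +-*-Solver using (solve; _:=_; _:+_; _:-_)
  eq : ∀ p → p ≡ (p ℚ.+ p) ℚ.- p
  eq = solve 1 (λ p → p := (p :+ p) :- p) refl

-- Eventually δ * ∣y∣ ≤ ∣x * y∣ ≤ δ * ε, and δ cancels.
apart₀∧x*y≈0⇒y≈0 : Apart₀ x → x * y ≈ 0ℝ → y ≈ 0ℝ
apart₀∧x*y≈0⇒y≈0 {x} {y} (δ , 0<δ , M , δ≤) xy≈0 = eventually-small⇒≈0 λ ε 0<ε →
  let N , f  = ≈0⇒eventually-small xy≈0 (δ ℚ.* ε) (0<δε ε 0<ε)
      R , to = both M N
  in  R , λ n p → ℚ.*-cancelˡ-≤-pos δ (begin
        δ ℚ.* ∣ seq y n ∣            ≤⟨ ℚ.*-monoʳ-≤-nonNeg (∣ seq y n ∣) {{ℚ.∣-∣-nonNeg (seq y n)}}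
                                          (δ≤ n (proj₁ (to p))) ⟩
        ∣ seq x n ∣ ℚ.* ∣ seq y n ∣  ≡⟨ ℚ.∣p*q∣≡∣p∣*∣q∣ (seq x n) (seq y n) ⟨
        ∣ seq x n ℚ.* seq y n ∣      ≤⟨ f n (proj₂ (to p)) ⟩
        δ ℚ.* ε                      ∎)
  where
  open ℚ.≤-Reasoning
  instance
    δ⁺ : ℚ.Positive δ
    δ⁺ = ℚ.positive 0<δ
  0<δε : ∀ ε → 0ℚ ℚ.< ε → 0ℚ ℚ.< δ ℚ.* ε
  0<δε ε 0<ε = ℚ.positive⁻¹ (δ ℚ.* ε) {{ℚ.pos*pos⇒pos δ ε {{ℚ.positive 0<ε}}}}

-- For each ε separately, either the tail is already within ε or apartness is available and the
-- hypothesis applies. A proof of `x ≈ 0ℝ` may therefore assume `Apart₀ x`.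
≈0-fromApart₀ : (Apart₀ x → x ≈ 0ℝ) → x ≈ 0ℝ
≈0-fromApart₀ {x} h = eventually-small⇒≈0 λ ε 0<ε → decide ε 0<ε (small⊎apart₀ x ε 0<ε)
  where
  decide : ∀ ε → 0ℚ ℚ.< ε → Eventually (λ n → ∣ seq x n ∣ ℚ.≤ ε) ⊎ Apart₀ x →
           Eventually (λ n → ∣ seq x n ∣ ℚ.≤ ε)
  decide ε 0<ε (inj₁ small) = small
  decide ε 0<ε (inj₂ apart) = ≈0⇒eventually-small (h apart) ε 0<ε

apart₀⇒≉0 : Apart₀ x → x ≉ 0ℝ
apart₀⇒≉0 {x} (δ , 0<δ , M , δ≤) x≈0 =
  let γ , 0<γ , γ+γ≡δ = halve δ 0<δ
      N , f           = ≈0⇒eventually-small x≈0 γ 0<γ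
      R , to          = both M N
      M≤R , N≤R       = to ℕ.≤-refl
      γ<δ             = subst₂ ℚ._<_ (ℚ.+-identityʳ γ) γ+γ≡δ (ℚ.+-monoʳ-< γ 0<γ)
  in  ℚ.<-irrefl refl (ℚ.<-≤-trans γ<δ (ℚ.≤-trans (δ≤ R M≤R) (f R N≤R)))

≈0-stable : ¬ (x ≉ 0ℝ) → x ≈ 0ℝ
≈0-stable h = ≈0-fromApart₀ λ apart → contradiction (apart₀⇒≉0 apart) h

-- The negation `x ≉ 0ℝ` supplies no lower bound by which to cancel `x`. Instead `y` is assumed
-- apart from 0 and cancelled, which gives `x ≈ 0ℝ`, a contradiction.
x*y≈0⇒x≉0⇒y≈0 : x * y ≈ 0ℝ → x ≉ 0ℝ → y ≈ 0ℝ
x*y≈0⇒x≉0⇒y≈0 {x} {y} xy≈0 x≉0 = ≈0-fromApart₀ λ apart →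
  contradiction (apart₀∧x*y≈0⇒y≈0 apart (≈-trans (*-comm y x) xy≈0)) x≉0

-- Stability replaces a case split on `x`: if the product is nonzero then so is `x`, hence `y ≈ 0ℝ`
-- and the product vanishes after all.
[x≉0⇒y≈0]⇒x*y≈0 : (x ≉ 0ℝ → y ≈ 0ℝ) → x * y ≈ 0ℝ
[x≉0⇒y≈0]⇒x*y≈0 {x} {y} h = ≈0-stable λ xy≉0 →
  xy≉0 (≈-trans (*-congˡ (h λ x≈0 → xy≉0 (≈-trans (*-congʳ x≈0) (zeroˡ y)))) (zeroʳ x))

-- Sums and matrices

0≤sum : (f : Vec n) → NonNegative f → 0ℝ ≤ sum f
0≤sum {ℕ.zero}  f f≥0 = ≈⇒≤ ≈-refl
0≤sum {ℕ.suc n} f f≥0 = ≤-trans (f≥0 zero) (0≤y⇒x≤x+y (f zero) (0≤sum (f ∘ suc) (f≥0 ∘ suc)))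

0≤x∧0≤y∧x+y≈0⇒x≈0 : 0ℝ ≤ x → 0ℝ ≤ y → x + y ≈ 0ℝ → x ≈ 0ℝ
0≤x∧0≤y∧x+y≈0⇒x≈0 {x} 0≤x 0≤y x+y≈0 = ≤-antisym (≤-trans (0≤y⇒x≤x+y x 0≤y) (≈⇒≤ x+y≈0)) 0≤x

-- The head and the sum of the tail are nonnegative and add up to 0, so each of them vanishes;
-- induction handles the tail.
sum≈0⇒≈0 : (f : Vec n) → NonNegative f → sum f ≈ 0ℝ → f ≈ᵛ 0ᵛ
sum≈0⇒≈0 f f≥0 eq zero = 0≤x∧0≤y∧x+y≈0⇒x≈0 (f≥0 zero) (0≤sum (f ∘ suc) (f≥0 ∘ suc)) eq
sum≈0⇒≈0 f f≥0 eq (suc i) = sum≈0⇒≈0 (f ∘ suc) (f≥0 ∘ suc)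
  (0≤x∧0≤y∧x+y≈0⇒x≈0 (0≤sum (f ∘ suc) (f≥0 ∘ suc)) (f≥0 zero)
    (≈-trans (+-comm (sum (f ∘ suc)) (f zero)) eq)) i

≈0⇒sum≈0 : (f : Vec n) → f ≈ᵛ 0ᵛ → sum f ≈ 0ℝ
≈0⇒sum≈0 {ℕ.zero}  f f≈0 = ≈-refl
≈0⇒sum≈0 {ℕ.suc n} f f≈0 =
  ≈-trans (+-cong (f≈0 zero) (≈0⇒sum≈0 (f ∘ suc) (f≈0 ∘ suc))) (+-identityʳ 0ℝ)

∙-congˡ : (a : Vec n) {b c : Vec n} → b ≈ᵛ c → a ∙ b ≈ a ∙ c
∙-congˡ a b≈c = sum-cong-≋ λ i → *-congˡ (b≈c i)

∙-congʳ : (c : Vec n) {a b : Vec n} → a ≈ᵛ b → a ∙ c ≈ b ∙ c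
∙-congʳ c a≈b = sum-cong-≋ λ i → *-congʳ (a≈b i)

∙-distribˡ-+ : (a b c : Vec n) → a ∙ (λ i → b i + c i) ≈ a ∙ b + a ∙ c
∙-distribˡ-+ a b c = ≈-trans (sum-cong-≋ λ i → distribˡ (a i) (b i) (c i))
  (∑-distrib-+ (λ i → a i * b i) (λ i → a i * c i))

∙-distribʳ-+ : (c a b : Vec n) → (λ i → a i + b i) ∙ c ≈ a ∙ c + b ∙ c
∙-distribʳ-+ c a b = ≈-trans (sum-cong-≋ λ i → distribʳ (c i) (a i) (b i))
  (∑-distrib-+ (λ i → a i * c i) (λ i → b i * c i))

·-∙ : (μ : ℝ) (a b : Vec n) → (μ · a) ∙ b ≈ μ * (a ∙ b)
·-∙ μ a b = ≈-trans (sum-cong-≋ λ i → *-assoc μ (a i) (b i))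
  (≈-sym (*-distribˡ-sum μ (λ i → a i * b i)))

∙-comm : (a b : Vec n) → a ∙ b ≈ b ∙ a
∙-comm a b = sum-cong-≋ λ i → *-comm (a i) (b i)

∙-· : (μ : ℝ) (a b : Vec n) → a ∙ (μ · b) ≈ μ * (a ∙ b)
∙-· μ a b = begin
  a ∙ (μ · b) ≈⟨ ∙-comm a (μ · b) ⟩
  (μ · b) ∙ a ≈⟨ ·-∙ μ b a ⟩
  μ * (b ∙ a) ≈⟨ *-congˡ (∙-comm b a) ⟩
  μ * (a ∙ b) ∎
  where open SetoidReasoning setoid

-- Both sides are the double sum of a i * A i j * b j, taken in the two orders.
ᵛ*ᴹ-∙ : (a : Vec n) (A : Matrix n) (b : Vec n) → (a ᵛ*ᴹ A) ∙ b ≈ a ∙ (A ᴹ*ᵛ b)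
ᵛ*ᴹ-∙ a A b = begin
  sum (λ j → sum (λ i → a i * A i j) * b j)
    ≈⟨ sum-cong-≋ (λ j → *-distribʳ-sum (b j) (λ i → a i * A i j)) ⟩
  sum (λ j → sum (λ i → a i * A i j * b j))
    ≈⟨ ∑-comm (λ j i → a i * A i j * b j) ⟩
  sum (λ i → sum (λ j → a i * A i j * b j))
    ≈⟨ sum-cong-≋ (λ i → sum-cong-≋ (λ j → *-assoc (a i) (A i j) (b j))) ⟩
  sum (λ i → sum (λ j → a i * (A i j * b j)))
    ≈⟨ sum-cong-≋ (λ i → ≈-sym (*-distribˡ-sum (a i) (λ j → A i j * b j))) ⟩
  sum (λ i → a i * sum (λ j → A i j * b j)) ∎
  where open SetoidReasoning setoid

*ᴹ-ᴹ*ᵛ : (A B : Matrix n) (b : Vec n) → (A *ᴹ B) ᴹ*ᵛ b ≈ᵛ A ᴹ*ᵛ B ᴹ*ᵛ b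
-- Row i of the product `A *ᴹ B` is the row vector `A i` times `B`.
*ᴹ-ᴹ*ᵛ A B b i = ᵛ*ᴹ-∙ (A i) B b

-- Brings the middle matrix between the two vectors named in the eigenvector hypotheses.
∙-*ᴹ*ᴹ : (a : Vec n) (A B E : Matrix n) (b : Vec n) →
         a ∙ ((A *ᴹ B *ᴹ E) ᴹ*ᵛ b) ≈ (a ᵛ*ᴹ A) ∙ (B ᴹ*ᵛ E ᴹ*ᵛ b)
∙-*ᴹ*ᴹ a A B E b = begin
  a ∙ ((A *ᴹ B *ᴹ E) ᴹ*ᵛ b)        ≈⟨ ∙-congˡ a (*ᴹ-ᴹ*ᵛ (A *ᴹ B) E b) ⟩
  a ∙ ((A *ᴹ B) ᴹ*ᵛ E ᴹ*ᵛ b)       ≈⟨ ∙-congˡ a (*ᴹ-ᴹ*ᵛ A B (E ᴹ*ᵛ b)) ⟩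
  a ∙ (A ᴹ*ᵛ B ᴹ*ᵛ E ᴹ*ᵛ b)        ≈⟨ ᵛ*ᴹ-∙ a A (B ᴹ*ᵛ E ᴹ*ᵛ b) ⟨
  (a ᵛ*ᴹ A) ∙ (B ᴹ*ᵛ E ᴹ*ᵛ b)      ∎
  where open SetoidReasoning setoid

_-ᴹ_ : Matrix n → Matrix n → Matrix n
(A -ᴹ B) i j = A i j + - B i j

-- Stated additively, it follows from distributivity over `_+_` and the entrywise identity (A - B) +
-- B ≈ A; no negation has to pass through a sum.
∙--ᴹ : (a : Vec n) (A B : Matrix n) (b : Vec n) →
       a ∙ ((A -ᴹ B) ᴹ*ᵛ b) + a ∙ (B ᴹ*ᵛ b) ≈ a ∙ (A ᴹ*ᵛ b)
∙--ᴹ a A B b = begin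
  a ∙ ((A -ᴹ B) ᴹ*ᵛ b) + a ∙ (B ᴹ*ᵛ b)
    ≈⟨ ∙-distribˡ-+ a ((A -ᴹ B) ᴹ*ᵛ b) (B ᴹ*ᵛ b) ⟨
  a ∙ (λ i → (A -ᴹ B) i ∙ b + B i ∙ b)
    ≈⟨ ∙-congˡ a (λ i → ∙-distribʳ-+ b ((A -ᴹ B) i) (B i)) ⟨
  a ∙ (λ i → (λ j → (A -ᴹ B) i j + B i j) ∙ b)
    ≈⟨ ∙-congˡ a (λ i → ∙-congʳ b (λ j → //-rightDividesˡ (B i j) (A i j))) ⟩
  a ∙ (A ᴹ*ᵛ b) ∎
  where
  open SetoidReasoning setoid

*-nonNegative : (a b : Vec n) → NonNegative a → NonNegative b → NonNegative (λ i → a i * b i)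
*-nonNegative a b a≥0 b≥0 i = 0≤x*y (a≥0 i) (b≥0 i)

-- Comparison of the two eigenvalues

lemma3p2 : (n : ℕ) (C C′ P Q : Matrix n) (λ₁ λ₁′ : ℝ) (u v : Vec n) →
    (P *ᴹ C *ᴹ Q) ≥ᴹ (P *ᴹ C′ *ᴹ Q) →
    NonNegative u → IsRightEigenvector C′ λ₁′ (Q ᴹ*ᵛ u) →
    NonNegative v → IsLeftEigenvector C λ₁ (v ᵛ*ᴹ P) →
    (v ᵛ*ᴹ P) ∙ (Q ᴹ*ᵛ u) > 0ℝ →
    (λ₁ ≥ λ₁′) ×
    (λ₁ ≈ λ₁′ ⇔
      ((i j : Fin n) → v i ≉ 0ℝ → u j ≉ 0ℝ →
        (P *ᴹ C′ *ᴹ Q) i j ≈ (P *ᴹ C *ᴹ Q) i j))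
lemma3p2 n C C′ P Q λ₁ λ₁′ u v M≥M′ u≥0 (C′Qu≈ , _) v≥0 (vPC≈ , _) s>0 =
  -- The positive factor `s` is cancelled from 0 ≤ (λ₁ - λ₁′) * s.
  0≤y-x⇒x≤y (0≤x*y∧0<y⇒0≤x (≤-trans 0≤vDu (≈⇒≤ vDu≈)) s>0) , mk⇔ to from
  where
  open SetoidReasoning setoid
  M M′ D : Matrix n
  M  = P *ᴹ C *ᴹ Q
  M′ = P *ᴹ C′ *ᴹ Q
  D  = M -ᴹ M′

  s : ℝ
  s = (v ᵛ*ᴹ P) ∙ (Q ᴹ*ᵛ u)

  vMu≈ : v ∙ (M ᴹ*ᵛ u) ≈ λ₁ * s
  vMu≈ = begin
    v ∙ (M ᴹ*ᵛ u)                        ≈⟨ ∙-*ᴹ*ᴹ v P C Q u ⟩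
    -- `C` has to act on the left vector here, whereas `C′` below stays with the right one.
    (v ᵛ*ᴹ P) ∙ (C ᴹ*ᵛ Q ᴹ*ᵛ u)          ≈⟨ ᵛ*ᴹ-∙ (v ᵛ*ᴹ P) C (Q ᴹ*ᵛ u) ⟨
    (v ᵛ*ᴹ P ᵛ*ᴹ C) ∙ (Q ᴹ*ᵛ u)          ≈⟨ ∙-congʳ (Q ᴹ*ᵛ u) vPC≈ ⟩
    (λ₁ · (v ᵛ*ᴹ P)) ∙ (Q ᴹ*ᵛ u)         ≈⟨ ·-∙ λ₁ (v ᵛ*ᴹ P) (Q ᴹ*ᵛ u) ⟩
    λ₁ * s                               ∎

  vM′u≈ : v ∙ (M′ ᴹ*ᵛ u) ≈ λ₁′ * s
  vM′u≈ = begin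
    v ∙ (M′ ᴹ*ᵛ u)                       ≈⟨ ∙-*ᴹ*ᴹ v P C′ Q u ⟩
    (v ᵛ*ᴹ P) ∙ (C′ ᴹ*ᵛ Q ᴹ*ᵛ u)         ≈⟨ ∙-congˡ (v ᵛ*ᴹ P) C′Qu≈ ⟩
    (v ᵛ*ᴹ P) ∙ (λ₁′ · (Q ᴹ*ᵛ u))        ≈⟨ ∙-· λ₁′ (v ᵛ*ᴹ P) (Q ᴹ*ᵛ u) ⟩
    λ₁′ * s                              ∎

  vDu≈ : v ∙ (D ᴹ*ᵛ u) ≈ (λ₁ + - λ₁′) * s
  vDu≈ = begin
    v ∙ (D ᴹ*ᵛ u)
      ≈⟨ //-rightDividesʳ (v ∙ (M′ ᴹ*ᵛ u)) (v ∙ (D ᴹ*ᵛ u)) ⟨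
    (v ∙ (D ᴹ*ᵛ u) + v ∙ (M′ ᴹ*ᵛ u)) + - (v ∙ (M′ ᴹ*ᵛ u))
      ≈⟨ +-cong (∙--ᴹ v M M′ u) ≈-refl ⟩
    v ∙ (M ᴹ*ᵛ u) + - (v ∙ (M′ ᴹ*ᵛ u))
      ≈⟨ +-cong vMu≈ (-‿cong vM′u≈) ⟩
    λ₁ * s + - (λ₁′ * s)
      ≈⟨ [y-z]x≈yx-zx s λ₁ λ₁′ ⟨
    (λ₁ + - λ₁′) * s ∎

  Dᵢⱼuⱼ≥0 : ∀ i → NonNegative λ j → D i j * u j
  Dᵢⱼuⱼ≥0 i = *-nonNegative (D i) u (λ j → x≤y⇒0≤y-x (M≥M′ i j)) u≥0

  vᵢDuᵢ≥0 : NonNegative λ i → v i * (D ᴹ*ᵛ u) i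
  vᵢDuᵢ≥0 = *-nonNegative v (D ᴹ*ᵛ u) v≥0 λ i → 0≤sum (λ j → D i j * u j) (Dᵢⱼuⱼ≥0 i)

  0≤vDu : 0ℝ ≤ v ∙ (D ᴹ*ᵛ u)
  0≤vDu = 0≤sum (λ i → v i * (D ᴹ*ᵛ u) i) vᵢDuᵢ≥0

  to : λ₁ ≈ λ₁′ → ∀ i j → v i ≉ 0ℝ → u j ≉ 0ℝ → M′ i j ≈ M i j
  to λ₁≈λ₁′ i j vᵢ≉0 uⱼ≉0 = ≈-sym (x∙y⁻¹≈ε⇒x≈y (M i j) (M′ i j) Dᵢⱼ≈0)
    where
    vDu≈0 : v ∙ (D ᴹ*ᵛ u) ≈ 0ℝ
    vDu≈0 = ≈-trans vDu≈ (≈-trans (*-congʳ (x≈y⇒x∙y⁻¹≈ε λ₁≈λ₁′)) (zeroˡ s))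
    Duᵢ≈0 : (D ᴹ*ᵛ u) i ≈ 0ℝ
    -- Vanishing is extracted in two stages: the outer sum together with v i ≉ 0 kills the inner sum
    -- of row i, then the inner sum together with u j ≉ 0 kills the entry.
    Duᵢ≈0 = x*y≈0⇒x≉0⇒y≈0 (sum≈0⇒≈0 (λ i → v i * (D ᴹ*ᵛ u) i) vᵢDuᵢ≥0 vDu≈0 i) vᵢ≉0
    Dᵢⱼ≈0 : D i j ≈ 0ℝ
    Dᵢⱼ≈0 = x*y≈0⇒x≉0⇒y≈0
      (≈-trans (*-comm (u j) (D i j)) (sum≈0⇒≈0 (λ j → D i j * u j) (Dᵢⱼuⱼ≥0 i) Duᵢ≈0 j)) uⱼ≉0

  from : (∀ i j → v i ≉ 0ℝ → u j ≉ 0ℝ → M′ i j ≈ M i j) → λ₁ ≈ λ₁′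
  -- Positivity of `s` gives an explicit apartness bound, so `s` cancels from s * (λ₁ - λ₁′) ≈ 0.
  from M′≈M = x∙y⁻¹≈ε⇒x≈y λ₁ λ₁′ (apart₀∧x*y≈0⇒y≈0 (0<x⇒apart₀ s>0)
    (≈-trans (*-comm s (λ₁ + - λ₁′)) (≈-trans (≈-sym vDu≈) vDu≈0)))
    where
    vDu≈0 : v ∙ (D ᴹ*ᵛ u) ≈ 0ℝ
    -- Each term needs to be shown zero only under v i ≉ 0 and u j ≉ 0, which is exactly where the
    -- entries are assumed equal.
    vDu≈0 = ≈0⇒sum≈0 (λ i → v i * (D ᴹ*ᵛ u) i) λ i → [x≉0⇒y≈0]⇒x*y≈0 λ vᵢ≉0 →
      ≈0⇒sum≈0 (λ j → D i j * u j) λ j → ≈-trans (*-comm (D i j) (u j))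
        ([x≉0⇒y≈0]⇒x*y≈0 λ uⱼ≉0 → x≈y⇒x∙y⁻¹≈ε (≈-sym (M′≈M i j vᵢ≉0 uⱼ≉0)))
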